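{- For every $s\ge1$, the logic $\mathsf L(\mathfrak F_2+\mathfrak F_s)$ has nullary unification.
   Context: A frame is a finite poset with a least element; $\mathsf L(\mathfrak F)$ is the set of intuitionistic formulas valid in all Kripke models over $\mathfrak F$. For $n\ge2$ the $n$-fork $\mathfrak F_n$ is a root with $n$ pairwise incomparable maximal elements above it; $\mathfrak F_1$ is the two-element chain. For disjoint frames $\mathfrak F=(W,\le_W,w_0)$, $\mathfrak G=(U,\le_U,u_0)$, the join $\mathfrak F+\mathfrak G$ is $W\cup U$ rooted at $w_0$ with $x\le y$ iff $x\le_W y$ or $x\le_U y$ or ($x\in W$ and $y\in U$). Unification in a logic $\mathsf L$ is nullary if some $\mathsf L$-unifiable formula has no minimal (w.r.t. inclusion) complete set of unifiers, where a set $\Sigma$ of unifiers of $A$ is complete if every unifier $\mu$ of $A$ satisfies $\alpha\circ\varepsilon=_{\mathsf L}\mu$ for some $\varepsilon\in\Sigma$ and some substitution $\alpha$. -}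

module Defs where

open import Data.Nat using (ℕ; zero; suc; _+_; _≥_)
open import Data.Fin using (Fin; zero; suc)
open import Data.Fin.Properties using (+↔⊎)
open import Data.Bool using (Bool; true; false)
open import Data.Empty using (⊥)
open import Data.Product using (Σ; _×_; _,_; ∃)
open import Data.Sum using (_⊎_; inj₁; inj₂)
open import Data.Sum.Function.Propositional using (_⊎-↔_)
open import Function.Bundles using (_↔_)
open import Function.Properties.Inverse using (↔-trans; ↔-sym; ↔-refl)
open import Relation.Nullary using (¬_)
open import Relation.Binary.PropositionalEquality using (_≡_; refl; sym; trans)

infixr 6 _∧_
infixr 5 _∨_
infixr 4 _⇒_

data Fm : Set where
  var : ℕ → Fm
  ⊥̇   : Fm
  _∧_ : Fm → Fm → Fm
  _∨_ : Fm → Fm → Fm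
  _⇒_ : Fm → Fm → Fm

_⇔_ : Fm → Fm → Fm
A ⇔ B = (A ⇒ B) ∧ (B ⇒ A)

Subst : Set
Subst = ℕ → Fm

_[_] : Fm → Subst → Fm
var x   [ σ ] = σ x
⊥̇       [ σ ] = ⊥̇
(A ∧ B) [ σ ] = (A [ σ ]) ∧ (B [ σ ])
(A ∨ B) [ σ ] = (A [ σ ]) ∨ (B [ σ ])
(A ⇒ B) [ σ ] = (A [ σ ]) ⇒ (B [ σ ])

_∘ˢ_ : Subst → Subst → Subst
(α ∘ˢ ε) x = ε x [ α ]

record Frame : Set₁ where
  field
    W       : Set
    _≤_     : W → W → Set
    ≤-refl  : ∀ x → x ≤ x
    ≤-trans : ∀ {x y z} → x ≤ y → y ≤ z → x ≤ z
    ≤-antisym : ∀ {x y} → x ≤ y → y ≤ x → x ≡ y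
    root    : W
    least   : ∀ x → root ≤ x
    finite  : Σ ℕ λ n → W ↔ Fin n

module _ (F : Frame) where
  open Frame F

  record Valuation : Set where
    field
      val  : ℕ → W → Bool
      mono : ∀ p {x y} → x ≤ y → val p x ≡ true → val p y ≡ true

  open Valuation

  _,_⊩_ : Valuation → W → Fm → Set
  V , w ⊩ var p   = val V p w ≡ true
  V , w ⊩ ⊥̇       = ⊥
  V , w ⊩ (A ∧ B) = (V , w ⊩ A) × (V , w ⊩ B)
  V , w ⊩ (A ∨ B) = (V , w ⊩ A) ⊎ (V , w ⊩ B)
  V , w ⊩ (A ⇒ B) = ∀ v → w ≤ v → V , v ⊩ A → V , v ⊩ B

  Valid : Fm → Set
  Valid A = ∀ (V : Valuation) (w : W) → V , w ⊩ A

module Unification (F : Frame) where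

  _∈L : Fm → Set
  A ∈L = Valid F A

  _=L_ : Fm → Fm → Set
  A =L B = (A ⇔ B) ∈L

  _=Lˢ_ : Subst → Subst → Set
  σ =Lˢ τ = ∀ x → σ x =L τ x

  Unifier : Fm → Subst → Set
  Unifier A σ = (A [ σ ]) ∈L

  Unifiable : Fm → Set
  Unifiable A = ∃ λ σ → Unifier A σ

  SubstSet : Set₁
  SubstSet = Subst → Set

  _⊆ˢ_ : SubstSet → SubstSet → Set
  Σ₁ ⊆ˢ Σ₂ = ∀ σ → Σ₁ σ → Σ₂ σ

  Complete : Fm → SubstSet → Set
  Complete A Σ′ =
    (∀ ε → Σ′ ε → Unifier A ε) ×
    (∀ μ → Unifier A μ → Σ Subst λ ε → Σ Subst λ α → Σ′ ε × ((α ∘ˢ ε) =Lˢ μ))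

  MinimalComplete : Fm → SubstSet → Set₁
  MinimalComplete A Σ′ =
    Complete A Σ′ × (∀ (Σ″ : SubstSet) → Σ″ ⊆ˢ Σ′ → Complete A Σ″ → Σ′ ⊆ˢ Σ″)

  NullaryUnification : Set₁
  NullaryUnification =
    Σ Fm λ A → Unifiable A × ¬ (Σ SubstSet λ Σ′ → MinimalComplete A Σ′)

data _≤F_ {n : ℕ} : Fin (suc n) → Fin (suc n) → Set where
  ≤-same : ∀ {x} → x ≤F x
  ≤-root : ∀ {y} → zero ≤F y

Fork : ℕ → Frame
Fork n = record
  { W = Fin (suc n)
  ; _≤_ = _≤F_
  ; ≤-refl = λ _ → ≤-same
  ; ≤-trans = tr
  ; ≤-antisym = an
  ; root = zero
  ; least = λ _ → ≤-root
  ; finite = suc n , ↔-refl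
  }
  where
  tr : ∀ {x y z : Fin (suc n)} → x ≤F y → y ≤F z → x ≤F z
  tr ≤-same q = q
  tr ≤-root q = ≤-root
  an : ∀ {x y : Fin (suc n)} → x ≤F y → y ≤F x → x ≡ y
  an ≤-same _ = refl
  an ≤-root ≤-same = refl
  an ≤-root ≤-root = refl

module _ (F G : Frame) where
  private
    module F = Frame F
    module G = Frame G

  data _≤J_ : F.W ⊎ G.W → F.W ⊎ G.W → Set where
    inl≤  : ∀ {a b} → a F.≤ b → inj₁ a ≤J inj₁ b
    inr≤  : ∀ {a b} → a G.≤ b → inj₂ a ≤J inj₂ b
    cross : ∀ {a b} → inj₁ a ≤J inj₂ b

  private
    reflJ : ∀ x → x ≤J x
    reflJ (inj₁ a) = inl≤ (F.≤-refl a)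
    reflJ (inj₂ a) = inr≤ (G.≤-refl a)

    transJ : ∀ {x y z} → x ≤J y → y ≤J z → x ≤J z
    transJ (inl≤ p) (inl≤ q) = inl≤ (F.≤-trans p q)
    transJ (inl≤ p) cross    = cross
    transJ (inr≤ p) (inr≤ q) = inr≤ (G.≤-trans p q)
    transJ cross    (inr≤ q) = cross

    antiJ : ∀ {x y} → x ≤J y → y ≤J x → x ≡ y
    antiJ (inl≤ p) (inl≤ q) with F.≤-antisym p q
    ... | refl = refl
    antiJ (inr≤ p) (inr≤ q) with G.≤-antisym p q
    ... | refl = refl
    antiJ cross ()

    leastJ : ∀ x → inj₁ F.root ≤J x
    leastJ (inj₁ a) = inl≤ (F.least a)
    leastJ (inj₂ a) = cross

    finJ : Σ ℕ λ n → (F.W ⊎ G.W) ↔ Fin n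
    finJ with F.finite | G.finite
    ... | m , f | k , g = m + k , ↔-trans (f ⊎-↔ g) (↔-sym (+↔⊎ {m} {k}))

  _+ᶠ_ : Frame
  _+ᶠ_ = record
    { W = F.W ⊎ G.W
    ; _≤_ = _≤J_
    ; ≤-refl = reflJ
    ; ≤-trans = transJ
    ; ≤-antisym = antiJ
    ; root = inj₁ F.root
    ; least = leastJ
    ; finite = finJ
    }

{-# OPTIONS --safe #-}
module Submission where

open import Defs
open import Data.Nat using (ℕ; _≥_)
open import Data.Nat using (zero; suc; _<_; _⊔_; _^_; _≡ᵇ_; s≤s)
open import Data.Nat.Properties
  using (≤-refl; n<1+n; <-≤-trans; m≤m⊔n; m≤n⊔m; <⇒≢; m≤n⇒m<n∨m≡n; ≡ᵇ⇒≡; ≡⇒≡ᵇ)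
open import Data.Fin using (Fin; zero; suc; toℕ; fromℕ<; funToFin; finToFun)
open import Data.Fin.Properties
  using (_≟_; all?; pigeonhole; toℕ<n; toℕ-fromℕ<; finToFun-funToFin; 2↔Bool)
open import Data.Bool using (Bool; true; false)
open import Data.Bool.Properties using (T-≡) renaming (_≟_ to _≟ᵇ_)
open import Data.Empty using (⊥-elim)
open import Data.Product using (Σ; _×_; _,_; ∃; proj₁; proj₂)
open import Data.Sum using (_⊎_; inj₁; inj₂)
open import Data.Unit using (⊤; tt)
open import Function.Base using (_∘_; id)
open import Function.Bundles using (Inverse; Equivalence; mk⇔)
open import Relation.Nullary using (Dec; yes; no; does; ¬_; contradiction)
open import Relation.Nullary.Decidable using (map′; _×-dec_; _⊎-dec_; _→-dec_; dec-true; does-⇔)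
open import Relation.Binary.PropositionalEquality
  using (_≡_; _≢_; refl; sym; trans; cong; cong₂; subst; subst₂)

-- Let p, q be the variables 0, 1 and A = ¬¬p ∧ ¬¬q ∧ (p ∨ q). Any two unifiers σ, τ of A are instances of
-- x ↦ (¬y → σ x) ∧ (¬¬y → τ x) with y fresh, which again unifies A: worlds leaving y undecided see only maximal
-- worlds that decide it, and there everything is forced. Hence a minimal complete set would yield a most
-- general unifier of A.
-- There is none. Let Δ be a conjunction of linearity axioms for x₁, …, x_l, relativised so that it can fail only
-- at the root, and μ the unifier p ↦ (y → Δ), q ↦ (y ∨ Δ). Consider models whose arms a, b force different
-- variables xᵢ, xⱼ (and everything is forced above them); at the root μ p fails if y is true there, and μ q fails
-- otherwise. If α ∘ ε = μ and ε p, ε q use k variables with 2^k < l, then α sends two arms i ≠ j to arms equal on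
-- these variables. After α the two models (y true or false at the root) are roots over one common arm, so they
-- can be placed as the two arms of a new model, at whose root neither ε p nor ε q is forced.

-- Substitution and variable bounds for formulas.

infix 8 ¬̇_

¬̇_ : Fm → Fm
¬̇ A = A ⇒ ⊥̇

⊤̇ : Fm
⊤̇ = ¬̇ ⊥̇

[]-∘ : ∀ A (σ τ : Subst) → (A [ σ ]) [ τ ] ≡ A [ τ ∘ˢ σ ]
[]-∘ (var x) σ τ = refl
[]-∘ ⊥̇       σ τ = refl
[]-∘ (A ∧ B) σ τ = cong₂ _∧_ ([]-∘ A σ τ) ([]-∘ B σ τ)
[]-∘ (A ∨ B) σ τ = cong₂ _∨_ ([]-∘ A σ τ) ([]-∘ B σ τ)
[]-∘ (A ⇒ B) σ τ = cong₂ _⇒_ ([]-∘ A σ τ) ([]-∘ B σ τ)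

[]-var : ∀ A → A [ var ] ≡ A
[]-var (var x) = refl
[]-var ⊥̇       = refl
[]-var (A ∧ B) = cong₂ _∧_ ([]-var A) ([]-var B)
[]-var (A ∨ B) = cong₂ _∨_ ([]-var A) ([]-var B)
[]-var (A ⇒ B) = cong₂ _⇒_ ([]-var A) ([]-var B)

shift : Subst
shift x = var (suc x)

instantiate₀ : Fm → Subst
instantiate₀ C zero    = C
instantiate₀ C (suc x) = var x

shift-instantiate₀ : ∀ A C → (A [ shift ]) [ instantiate₀ C ] ≡ A
shift-instantiate₀ A C = trans ([]-∘ A shift (instantiate₀ C)) ([]-var A)

AllVars : (ℕ → Set) → Fm → Set
AllVars P (var x) = P x
AllVars P ⊥̇       = ⊤
AllVars P (A ∧ B) = AllVars P A × AllVars P B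
AllVars P (A ∨ B) = AllVars P A × AllVars P B
AllVars P (A ⇒ B) = AllVars P A × AllVars P B

AllVars-map : ∀ {P Q : ℕ → Set} → (∀ {x} → P x → Q x) → ∀ A → AllVars P A → AllVars Q A
AllVars-map f (var x) p       = f p
AllVars-map f ⊥̇       p       = tt
AllVars-map f (A ∧ B) (p , q) = AllVars-map f A p , AllVars-map f B q
AllVars-map f (A ∨ B) (p , q) = AllVars-map f A p , AllVars-map f B q
AllVars-map f (A ⇒ B) (p , q) = AllVars-map f A p , AllVars-map f B q

AllVars-universal : ∀ {P : ℕ → Set} → (∀ x → P x) → ∀ A → AllVars P A
AllVars-universal f (var x) = f x
AllVars-universal f ⊥̇       = tt
AllVars-universal f (A ∧ B) = AllVars-universal f A , AllVars-universal f B
AllVars-universal f (A ∨ B) = AllVars-universal f A , AllVars-universal f B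
AllVars-universal f (A ⇒ B) = AllVars-universal f A , AllVars-universal f B

∃-bound : ∀ A → ∃ λ k → AllVars (_< k) A
∃-bound₂ : ∀ A B → ∃ λ k → AllVars (_< k) A × AllVars (_< k) B

∃-bound (var x) = suc x , ≤-refl
∃-bound ⊥̇       = 0 , tt
∃-bound (A ∧ B) = ∃-bound₂ A B
∃-bound (A ∨ B) = ∃-bound₂ A B
∃-bound (A ⇒ B) = ∃-bound₂ A B

∃-bound₂ A B with ∃-bound A | ∃-bound B
... | k , p | l , q = k ⊔ l
                    , AllVars-map (λ x<k → <-≤-trans x<k (m≤m⊔n k l)) A p
                    , AllVars-map (λ x<l → <-≤-trans x<l (m≤n⊔m k l)) B q

⋀< : ℕ → (ℕ → Fm) → Fm
⋀< zero    f = ⊤̇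
⋀< (suc n) f = f n ∧ ⋀< n f

-- Decidable Kripke semantics, pullback along substitutions, bisimulation.

module Semantics (F : Frame) (_≤?_ : ∀ x y → Dec (Frame._≤_ F x y)) where
  open Frame F using (W; finite) renaming (_≤_ to _⊑_; ≤-refl to ⊑-refl; ≤-trans to ⊑-trans)
  open Valuation
  open Unification F

  infix 3 _∣_⊩_
  _∣_⊩_ : Valuation F → W → Fm → Set
  _∣_⊩_ = _,_⊩_ F

  persistent : ∀ V A {x y} → x ⊑ y → V ∣ x ⊩ A → V ∣ y ⊩ A
  persistent V (var p) x⊑y h        = mono V p x⊑y h
  persistent V (A ∧ B) x⊑y (h , k)  = persistent V A x⊑y h , persistent V B x⊑y k
  persistent V (A ∨ B) x⊑y (inj₁ h) = inj₁ (persistent V A x⊑y h)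
  persistent V (A ∨ B) x⊑y (inj₂ h) = inj₂ (persistent V B x⊑y h)
  persistent V (A ⇒ B) x⊑y h        = λ v y⊑v → h v (⊑-trans x⊑y y⊑v)

  all-worlds? : ∀ {P : W → Set} → (∀ w → Dec (P w)) → Dec (∀ w → P w)
  all-worlds? {P} P? = map′ (λ h w → subst P (strictlyInverseʳ w) (h (to w))) (λ h i → h (from i))
                            (all? (P? ∘ from))
    where open Inverse (proj₂ finite)

  forces? : ∀ V w A → Dec (V ∣ w ⊩ A)
  forces? V w (var p) = val V p w ≟ᵇ true
  forces? V w ⊥̇       = no id
  forces? V w (A ∧ B) = forces? V w A ×-dec forces? V w B
  forces? V w (A ∨ B) = forces? V w A ⊎-dec forces? V w B
  forces? V w (A ⇒ B) = all-worlds? λ v → (w ≤? v) →-dec (forces? V v A →-dec forces? V v B)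

  does⁻ : ∀ {P : Set} (P? : Dec P) → does P? ≡ true → P
  does⁻ (yes p) _ = p

  -- Valuations are Boolean, so it is the decidability of forcing that lets `α p` act as an atom.
  pullback : Subst → Valuation F → Valuation F
  pullback α V = record
    { val  = λ p w → does (forces? V w (α p))
    ; mono = λ p x⊑y h → dec-true (forces? V _ (α p)) (persistent V (α p) x⊑y (does⁻ (forces? V _ (α p)) h))
    }

  module _ (α : Subst) (V : Valuation F) where
    ⊩-[]⁺ : ∀ A {w} → pullback α V ∣ w ⊩ A → V ∣ w ⊩ A [ α ]
    ⊩-[]⁻ : ∀ A {w} → V ∣ w ⊩ A [ α ] → pullback α V ∣ w ⊩ A

    ⊩-[]⁺ (var p) {w} h        = does⁻ (forces? V w (α p)) h
    ⊩-[]⁺ (A ∧ B)     (h , k)  = ⊩-[]⁺ A h , ⊩-[]⁺ B k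
    ⊩-[]⁺ (A ∨ B)     (inj₁ h) = inj₁ (⊩-[]⁺ A h)
    ⊩-[]⁺ (A ∨ B)     (inj₂ h) = inj₂ (⊩-[]⁺ B h)
    ⊩-[]⁺ (A ⇒ B)     h        = λ v w⊑v k → ⊩-[]⁺ B (h v w⊑v (⊩-[]⁻ A k))

    ⊩-[]⁻ (var p) {w} h        = dec-true (forces? V w (α p)) h
    ⊩-[]⁻ (A ∧ B)     (h , k)  = ⊩-[]⁻ A h , ⊩-[]⁻ B k
    ⊩-[]⁻ (A ∨ B)     (inj₁ h) = inj₁ (⊩-[]⁻ A h)
    ⊩-[]⁻ (A ∨ B)     (inj₂ h) = inj₂ (⊩-[]⁻ B h)
    ⊩-[]⁻ (A ⇒ B)     h        = λ v w⊑v k → ⊩-[]⁻ B (h v w⊑v (⊩-[]⁺ A k))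

  Valid-[] : ∀ A α → Valid F A → Valid F (A [ α ])
  Valid-[] A α valid V w = ⊩-[]⁺ α V A (valid (pullback α V) w)

  module _ {V V′ : Valuation F} {P : ℕ → Set} {Z : W → W → Set}
           (atom  : ∀ {x w w′} → P x → Z w w′ → val V x w ≡ val V′ x w′)
           (forth : ∀ {w w′ v} → Z w w′ → w ⊑ v → ∃ λ v′ → w′ ⊑ v′ × Z v v′)
           (back  : ∀ {w w′ v′} → Z w w′ → w′ ⊑ v′ → ∃ λ v → w ⊑ v × Z v v′) where

    -- `Z` has to respect only the atoms in `P`, so formulas in few variables transfer between
    -- models that differ on the others. Premises of implications are contravariant, hence the
    -- mutual induction.
    bisimilar⁺ : ∀ A {w w′} → AllVars P A → Z w w′ → V ∣ w ⊩ A → V′ ∣ w′ ⊩ A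
    bisimilar⁻ : ∀ A {w w′} → AllVars P A → Z w w′ → V′ ∣ w′ ⊩ A → V ∣ w ⊩ A

    bisimilar⁺ (var x) Px        z h        = trans (sym (atom Px z)) h
    bisimilar⁺ (A ∧ B) (PA , PB) z (h , k)  = bisimilar⁺ A PA z h , bisimilar⁺ B PB z k
    bisimilar⁺ (A ∨ B) (PA , PB) z (inj₁ h) = inj₁ (bisimilar⁺ A PA z h)
    bisimilar⁺ (A ∨ B) (PA , PB) z (inj₂ h) = inj₂ (bisimilar⁺ B PB z h)
    bisimilar⁺ (A ⇒ B) (PA , PB) z h v′ w′⊑v′ k with back z w′⊑v′
    ... | v , w⊑v , z′ = bisimilar⁺ B PB z′ (h v w⊑v (bisimilar⁻ A PA z′ k))

    bisimilar⁻ (var x) Px        z h        = trans (atom Px z) h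
    bisimilar⁻ (A ∧ B) (PA , PB) z (h , k)  = bisimilar⁻ A PA z h , bisimilar⁻ B PB z k
    bisimilar⁻ (A ∨ B) (PA , PB) z (inj₁ h) = inj₁ (bisimilar⁻ A PA z h)
    bisimilar⁻ (A ∨ B) (PA , PB) z (inj₂ h) = inj₂ (bisimilar⁻ B PB z h)
    bisimilar⁻ (A ⇒ B) (PA , PB) z h v w⊑v k with forth z w⊑v
    ... | v′ , w′⊑v′ , z′ = bisimilar⁻ B PB z′ (h v′ w′⊑v′ (bisimilar⁺ A PA z′ k))

  -- The instance preorder and minimal complete sets.

  infix 4 _≼_
  record _≼_ (μ ε : Subst) : Set where
    constructor via
    field
      factor  : Subst
      factors : (factor ∘ˢ ε) =Lˢ μ

  -- Validity is closed under substitution, so `β` may be applied to the equivalence of `α ∘ˢ ε` and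
  -- `ν`; chaining with the second equivalence gives the factor `β ∘ˢ α`.
  ≼-trans : ∀ {μ ν ε} → μ ≼ ν → ν ≼ ε → μ ≼ ε
  ≼-trans {μ} {ν} {ε} (via β βν=μ) (via α αε=ν) = via (β ∘ˢ α) λ x →
    subst (λ C → (C ⇔ μ x) ∈L) ([]-∘ (ε x) α β)
      (λ V w → (λ v w⊑v h → proj₁ (βν=μ x V v) v (⊑-refl v) (proj₁ (αε=ν′ x V v) v (⊑-refl v) h))
             , (λ v w⊑v h → proj₂ (αε=ν′ x V v) v (⊑-refl v) (proj₂ (βν=μ x V v) v (⊑-refl v) h)))
    where
    αε=ν′ : ∀ x → ((((α ∘ˢ ε) x) ⇔ ν x) [ β ]) ∈L
    αε=ν′ x = Valid-[] (((α ∘ˢ ε) x) ⇔ ν x) β (αε=ν x)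

  -- A complete set comes with a choice function ⌈_⌉ from unifiers to more general members. If μ′ ⋠ ⌈μ⌉, the
  -- members ⌈join ν μ′⌉ for varying ν form a complete subset that misses ⌈μ⌉.
  directed⇒¬minimal : ∀ A → Unifiable A →
    (∀ σ τ → Unifier A σ → Unifier A τ → Σ Subst λ ρ → Unifier A ρ × σ ≼ ρ × τ ≼ ρ) →
    (∀ ε → Unifier A ε → Σ Subst λ μ → Unifier A μ × ¬ (μ ≼ ε)) →
    ¬ (Σ SubstSet λ Σ′ → MinimalComplete A Σ′)
  directed⇒¬minimal A (μ₀ , u₀) directed unbounded (Σ′ , (sound , complete) , minimal) =
    impossible (minimal Σ″ Σ″⊆Σ′ (sound″ , complete″) ε (chosen∈Σ′ u₀))
    where
    chosen : ∀ {μ} → Unifier A μ → Subst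
    chosen u = proj₁ (complete _ u)

    chosen∈Σ′ : ∀ {μ} (u : Unifier A μ) → Σ′ (chosen u)
    chosen∈Σ′ u = proj₁ (proj₂ (proj₂ (complete _ u)))

    ≼chosen : ∀ {μ} (u : Unifier A μ) → μ ≼ chosen u
    ≼chosen u = via (proj₁ (proj₂ (complete _ u))) (proj₂ (proj₂ (proj₂ (complete _ u))))

    ε : Subst
    ε = chosen u₀

    μ′ : Subst
    μ′ = proj₁ (unbounded ε (sound ε (chosen∈Σ′ u₀)))

    u′ : Unifier A μ′
    u′ = proj₁ (proj₂ (unbounded ε (sound ε (chosen∈Σ′ u₀))))

    μ′⋠ε : ¬ (μ′ ≼ ε)
    μ′⋠ε = proj₂ (proj₂ (unbounded ε (sound ε (chosen∈Σ′ u₀))))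

    join : ∀ {ν} (u : Unifier A ν) → Σ Subst λ ρ → Unifier A ρ × ν ≼ ρ × μ′ ≼ ρ
    join u = directed _ μ′ u u′

    chosenJoin : ∀ {ν} → Unifier A ν → Subst
    chosenJoin u = chosen (proj₁ (proj₂ (join u)))

    Σ″ : SubstSet
    Σ″ τ = Σ Subst λ ν → Σ (Unifier A ν) λ u → chosenJoin u ≡ τ

    Σ″⊆Σ′ : Σ″ ⊆ˢ Σ′
    Σ″⊆Σ′ _ (_ , u , refl) = chosen∈Σ′ (proj₁ (proj₂ (join u)))

    sound″ : ∀ τ → Σ″ τ → Unifier A τ
    sound″ τ τ∈ = sound τ (Σ″⊆Σ′ τ τ∈)

    complete″ : ∀ ν → Unifier A ν → Σ Subst λ τ → Σ Subst λ α → Σ″ τ × ((α ∘ˢ τ) =Lˢ ν)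
    complete″ ν u with join u in eq
    ... | ρ , uρ , ν≼ρ , _ with ≼-trans ν≼ρ (≼chosen uρ)
    ...   | via α e = chosen uρ , α , (ν , u , cong (λ z → chosen (proj₁ (proj₂ z))) eq) , e

    impossible : ¬ (Σ″ ε)
    impossible (ν , u , eq) with join u
    ... | ρ , uρ , _ , μ′≼ρ = μ′⋠ε (subst (μ′ ≼_) eq (≼-trans μ′≼ρ (≼chosen uρ)))

-- Deciding the order of forks and joins.

_≤F?_ : ∀ {n} (x y : Fin (suc n)) → Dec (x ≤F y)
zero  ≤F? y     = yes ≤-root
suc x ≤F? zero  = no λ ()
suc x ≤F? suc y with x ≟ y
... | yes refl = yes ≤-same
... | no  x≢y  = no λ { ≤-same → x≢y refl }

module _ {F G : Frame} (_≤₁?_ : ∀ x y → Dec (Frame._≤_ F x y)) (_≤₂?_ : ∀ x y → Dec (Frame._≤_ G x y)) where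

  +ᶠ-≤? : ∀ x y → Dec (_≤J_ F G x y)
  +ᶠ-≤? (inj₁ x) (inj₁ y) = map′ inl≤ (λ { (inl≤ p) → p }) (x ≤₁? y)
  +ᶠ-≤? (inj₁ x) (inj₂ y) = yes cross
  +ᶠ-≤? (inj₂ x) (inj₁ y) = no λ ()
  +ᶠ-≤? (inj₂ x) (inj₂ y) = map′ inr≤ (λ { (inr≤ p) → p }) (x ≤₂? y)

-- The frame and its maximal worlds.

module ForkOverFork (n : ℕ) where

  -- Writing s as `suc n` guarantees that the world `leaf zero` exists.
  F : Frame
  F = Fork 2 +ᶠ Fork (suc n)

  open Frame F using (W) renaming (_≤_ to _⊑_; ≤-refl to ⊑-refl; ≤-trans to ⊑-trans)
  open Valuation
  open Unification F
  open Semantics F (+ᶠ-≤? _≤F?_ _≤F?_)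

  pattern r = inj₁ zero
  pattern a = inj₁ (suc zero)
  pattern b = inj₁ (suc (suc zero))
  pattern u = inj₂ zero
  pattern leaf i = inj₂ (suc i)

  data Max : W → Set where
    max : ∀ {i} → Max (leaf i)

  max-least : ∀ {m v} → Max m → m ⊑ v → v ≡ m
  max-least max (inr≤ ≤-same) = refl

  max-or-below-all : ∀ v → Max v ⊎ (∀ {m} → Max m → v ⊑ m)
  max-or-below-all (inj₁ _) = inj₂ λ { max → cross }
  max-or-below-all u        = inj₂ λ { max → inr≤ ≤-root }
  max-or-below-all (leaf i) = inj₁ max

  max-above : ∀ w → ∃ λ m → Max m × w ⊑ m
  max-above (inj₁ _) = leaf zero , max , cross
  max-above u        = leaf zero , max , inr≤ ≤-root
  max-above (leaf i) = leaf i , max , ⊑-refl _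

  ¬¬-from-max : ∀ V B → (∀ {m} → Max m → V ∣ m ⊩ B) → ∀ w → V ∣ w ⊩ ¬̇ ¬̇ B
  ¬¬-from-max V B atMax w v w⊑v ¬B with max-above v
  ... | m , max-m , v⊑m = ¬B m v⊑m (atMax max-m)

  max-from-¬¬ : ∀ V B {m} → Max m → V ∣ m ⊩ ¬̇ ¬̇ B → V ∣ m ⊩ B
  max-from-¬¬ V B {m} max-m h with forces? V m B
  ... | yes B⊩ = B⊩
  ... | no ¬B⊩ = ⊥-elim (h m (⊑-refl m) λ v m⊑v k → ¬B⊩ (subst (λ x → V ∣ x ⊩ B) (max-least max-m m⊑v) k))

  -- A non-maximal world sees every leaf, so a negation forced there excludes `B` at all leaves;
  -- each world forcing `B` would pass it on to some leaf.
  ¬-spreads : ∀ V B v → V ∣ v ⊩ ¬̇ B → Max v ⊎ (∀ w → V ∣ w ⊩ ¬̇ B)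
  ¬-spreads V B v h with max-or-below-all v
  ... | inj₁ max-v = inj₁ max-v
  ... | inj₂ v⊑max = inj₂ λ w w′ w⊑w′ k → let (m , max-m , w′⊑m) = max-above w′ in
                                          h m (v⊑max max-m) (persistent V B w′⊑m k)

  -- The formula to be unified and the directedness of its unifiers.

  goal : Fm
  goal = ¬̇ ¬̇ var 0 ∧ ¬̇ ¬̇ var 1 ∧ (var 0 ∨ var 1)

  goal-unifier : ∀ σ → (∀ V {m} → Max m → V ∣ m ⊩ σ 0) → (∀ V {m} → Max m → V ∣ m ⊩ σ 1) →
                 (∀ V w → V ∣ w ⊩ σ 0 ∨ σ 1) → Unifier goal σ
  goal-unifier σ h₀ h₁ h V w = ¬¬-from-max V (σ 0) (h₀ V) w , ¬¬-from-max V (σ 1) (h₁ V) w , h V w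

  module _ (σ τ : Subst) where
    private
      N : Fm
      N = ¬̇ var 0

    -- The shift reserves `var 0` as the fresh y.
    join : Subst
    join x = (N ⇒ σ x [ shift ]) ∧ (¬̇ N ⇒ τ x [ shift ])

    -- Putting `⊥̇` for y makes `N` valid, so the first conjunct collapses to `σ x` and the second
    -- is vacuous.
    ≼-joinˡ : σ ≼ join
    ≼-joinˡ = via (instantiate₀ ⊥̇) λ x → subst₂ (λ C D → Valid F (((⊤̇ ⇒ C) ∧ (¬̇ ⊤̇ ⇒ D)) ⇔ σ x))
      (sym (shift-instantiate₀ (σ x) ⊥̇)) (sym (shift-instantiate₀ (τ x) ⊥̇))
      λ V w → (λ v _ h → proj₁ h v (⊑-refl v) λ _ _ ())
            , (λ v _ h → (λ v′ v⊑v′ _ → persistent V (σ x) v⊑v′ h)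
                       , (λ v′ _ k → ⊥-elim (k v′ (⊑-refl v′) λ _ _ ())))

    ≼-joinʳ : τ ≼ join
    ≼-joinʳ = via (instantiate₀ ⊤̇) λ x → subst₂ (λ C D → Valid F (((¬̇ ⊤̇ ⇒ C) ∧ (¬̇ ¬̇ ⊤̇ ⇒ D)) ⇔ τ x))
      (sym (shift-instantiate₀ (σ x) ⊤̇)) (sym (shift-instantiate₀ (τ x) ⊤̇))
      λ V w → (λ v _ h → proj₂ h v (⊑-refl v) λ v′ _ k → k v′ (⊑-refl v′) λ _ _ ())
            , (λ v _ h → (λ v′ _ k → ⊥-elim (k v′ (⊑-refl v′) λ _ _ ()))
                       , (λ v′ v⊑v′ _ → persistent V (τ x) v⊑v′ h))

    module _ (uσ : Unifier goal σ) (uτ : Unifier goal τ) where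

      join-unifier : Unifier goal join
      join-unifier = goal-unifier join
        (λ V → atMax V 0 (λ w → proj₁ (vσ V w)) (λ w → proj₁ (vτ V w)))
        (λ V → atMax V 1 (λ w → proj₁ (proj₂ (vσ V w))) (λ w → proj₁ (proj₂ (vτ V w))))
        disjunction
        where
        vσ : Valid F ((goal [ σ ]) [ shift ])
        vσ = Valid-[] (goal [ σ ]) shift uσ

        vτ : Valid F ((goal [ τ ]) [ shift ])
        vτ = Valid-[] (goal [ τ ]) shift uτ

        atMax : ∀ V x → (∀ w → V ∣ w ⊩ ¬̇ ¬̇ (σ x [ shift ])) → (∀ w → V ∣ w ⊩ ¬̇ ¬̇ (τ x [ shift ])) →
                ∀ {m} → Max m → V ∣ m ⊩ join x
        atMax V x hσ hτ {m} max-m =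
            (λ v m⊑v _ → persistent V (σ x [ shift ]) m⊑v (max-from-¬¬ V (σ x [ shift ]) max-m (hσ m)))
          , (λ v m⊑v _ → persistent V (τ x [ shift ]) m⊑v (max-from-¬¬ V (τ x [ shift ]) max-m (hτ m)))

        ⊩join-left : ∀ V w x → V ∣ w ⊩ N → V ∣ w ⊩ σ x [ shift ] → V ∣ w ⊩ join x
        ⊩join-left V w x ¬y h = (λ v w⊑v _ → persistent V (σ x [ shift ]) w⊑v h)
                              , (λ v w⊑v ¬¬y → ⊥-elim (¬¬y v (⊑-refl v) (persistent V N w⊑v ¬y)))

        ⊩join-right : ∀ V w x → V ∣ w ⊩ ¬̇ N → V ∣ w ⊩ τ x [ shift ] → V ∣ w ⊩ join x
        ⊩join-right V w x ¬¬y h = (λ v w⊑v ¬y → ⊥-elim (¬¬y v w⊑v ¬y))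
                                , (λ v w⊑v _ → persistent V (τ x [ shift ]) w⊑v h)

        disjunction : ∀ V w → V ∣ w ⊩ join 0 ∨ join 1
        -- Once y is decided at w, one conjunct of `join x` is vacuous from w on, and the disjunct
        -- supplied by σ or by τ settles the other.
        disjunction V w with forces? V w N | forces? V w (¬̇ N)
        ... | yes ¬y | _ with proj₂ (proj₂ (vσ V w))
        ...   | inj₁ h = inj₁ (⊩join-left V w 0 ¬y h)
        ...   | inj₂ h = inj₂ (⊩join-left V w 1 ¬y h)
        disjunction V w | no _ | yes ¬¬y with proj₂ (proj₂ (vτ V w))
        ...   | inj₁ h = inj₁ (⊩join-right V w 0 ¬¬y h)
        ...   | inj₂ h = inj₂ (⊩join-right V w 1 ¬¬y h)
        -- Where the fresh variable is undecided, only maximal worlds above decide it, and there σ 0 and τ 0 hold.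
        disjunction V w | no ¬N | no ¬¬¬N = inj₁
          ( (λ v _ ¬y → onlyMax v (¬-spreads V (var 0) v ¬y) ¬N (vσ V v) (σ 0 [ shift ]) (λ h → proj₁ h))
          , (λ v _ ¬¬y → onlyMax v (¬-spreads V N v ¬¬y) ¬¬¬N (vτ V v) (τ 0 [ shift ]) (λ h → proj₁ h)))
          where
          onlyMax : ∀ {B C : Fm} v → Max v ⊎ (∀ w → V ∣ w ⊩ B) → ¬ (V ∣ w ⊩ B) → V ∣ v ⊩ C → ∀ D →
                    (V ∣ v ⊩ C → V ∣ v ⊩ ¬̇ ¬̇ D) → V ∣ v ⊩ D
          onlyMax v (inj₁ max-v) _ h D f = max-from-¬¬ V D max-v (f h)
          onlyMax v (inj₂ B⊩)    ¬B _ _ _ = contradiction (B⊩ w) ¬B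

  -- Linearity axioms and the separating unifiers.

  -- Any world other than the root sees a chain topped by leaves, so two incomparable worlds above
  -- it must be distinct leaves.
  comparable-or-max : ∀ {w v v′} → r ≢ w → w ⊑ v → w ⊑ v′ → v ⊑ v′ ⊎ v′ ⊑ v ⊎ Max v′
  comparable-or-max {r}      r≢w _ _ = contradiction refl r≢w
  comparable-or-max {leaf _} _ (inr≤ ≤-same) (inr≤ ≤-same) = inj₁ (⊑-refl _)
  comparable-or-max {u} {v} {leaf _} _ _ _ = inj₂ (inj₂ max)
  comparable-or-max {u} {v} {u} _ w⊑v _    = inj₂ (inj₁ w⊑v)
  comparable-or-max {inj₁ (suc x)} _ w⊑v (inl≤ ≤-same) = inj₂ (inj₁ w⊑v)
  comparable-or-max {inj₁ (suc x)} _ (inl≤ ≤-same) w⊑v′ = inj₁ w⊑v′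
  comparable-or-max {inj₁ (suc x)} {inj₂ v} {leaf _} _ _ _ = inj₂ (inj₂ max)
  comparable-or-max {inj₁ (suc x)} {inj₂ v} {u}      _ cross cross = inj₂ (inj₁ (inr≤ ≤-root))

  linear : Fm → Fm → Fm
  linear B C = (B ⇒ C) ∨ (C ⇒ B)

  -- Suppose some v′ above w forces `C` but not `B`. It is not maximal, hence comparable with each v
  -- above w that forces `B`; it cannot lie above v, so it lies below and passes `C` on to v. Thus
  -- `B ⇒ C` holds at w.
  ⊩linear : ∀ V B C → (∀ {m} → Max m → V ∣ m ⊩ B) → ∀ {w} → r ≢ w → V ∣ w ⊩ linear B C
  ⊩linear V B C atMax {w} r≢w with forces? V w (B ⇒ C)
  ... | yes h = inj₁ h
  ... | no ¬h = inj₂ C⇒B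
    where
    C⇒B : V ∣ w ⊩ C ⇒ B
    C⇒B v′ w⊑v′ k with forces? V v′ B
    ... | yes l = l
    ... | no ¬l = contradiction B⇒C ¬h
      where
      B⇒C : V ∣ w ⊩ B ⇒ C
      B⇒C v w⊑v l with comparable-or-max r≢w w⊑v w⊑v′
      ... | inj₁ v⊑v′             = contradiction (persistent V B v⊑v′ l) ¬l
      ... | inj₂ (inj₁ v′⊑v)      = persistent V C v′⊑v k
      ... | inj₂ (inj₂ max-v′)    = contradiction (atMax max-v′) ¬l

  -- Forced at every leaf, so that branching into the leaves cannot refute linearity.
  x̂ : ℕ → Fm
  x̂ i = ¬̇ ¬̇ var (suc i) ⇒ var (suc i)

  Δ : ℕ → Fm
  Δ l = ⋀< l λ i → ⋀< l λ j → linear (x̂ i) (x̂ j)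

  ⊩⋀<⁺ : ∀ V w l f → (∀ i → V ∣ w ⊩ f i) → V ∣ w ⊩ ⋀< l f
  ⊩⋀<⁺ V w zero    f h = λ _ _ ()
  ⊩⋀<⁺ V w (suc l) f h = h l , ⊩⋀<⁺ V w l f h

  ⊩⋀<⁻ : ∀ V w l f → V ∣ w ⊩ ⋀< l f → ∀ {i} → i < l → V ∣ w ⊩ f i
  ⊩⋀<⁻ V w (suc l) f (h , hs) (s≤s i≤l) with m≤n⇒m<n∨m≡n i≤l
  ... | inj₁ i<l  = ⊩⋀<⁻ V w l f hs i<l
  ... | inj₂ refl = h

  ⊩Δ : ∀ V l {w} → r ≢ w → V ∣ w ⊩ Δ l
  ⊩Δ V l r≢w = ⊩⋀<⁺ V _ l _ λ i → ⊩⋀<⁺ V _ l _ λ j → ⊩linear V (x̂ i) (x̂ j)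
    (λ max-m v m⊑v h → max-from-¬¬ V (var (suc i)) (subst Max (sym (max-least max-m m⊑v)) max-m) h) r≢w

  max≢r : ∀ {m} → Max m → r ≢ m
  max≢r max ()

  -- This is μ with `var 0` as y; the variables `suc i` inside `x̂ i` stay clear of it.
  separating : ℕ → Subst
  separating l 0 = var 0 ⇒ Δ l
  separating l 1 = var 0 ∨ Δ l
  separating l _ = ⊤̇

  separating-unifier : ∀ l → Unifier goal (separating l)
  separating-unifier l = goal-unifier (separating l)
    (λ V max-m v m⊑v _ → persistent V (Δ l) m⊑v (⊩Δ V l (max≢r max-m)))
    (λ V max-m → inj₂ (⊩Δ V l (max≢r max-m)))
    disjunction
    where
    disjunction : ∀ V w → V ∣ w ⊩ separating l 0 ∨ separating l 1
    disjunction V (inj₁ (suc x)) = inj₂ (inj₂ (⊩Δ V l λ ()))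
    disjunction V (inj₂ x)       = inj₂ (inj₂ (⊩Δ V l λ ()))
    -- If y fails at the root, the implication `var 0 ⇒ Δ l` is tested only at worlds above it,
    -- where `Δ l` always holds.
    disjunction V r with forces? V r (var 0)
    ... | yes y = inj₂ (inj₁ y)
    ... | no ¬y = inj₁ λ { r _ y → contradiction y ¬y
                         ; (inj₁ (suc x)) _ _ → ⊩Δ V l λ ()
                         ; (inj₂ x) _ _ → ⊩Δ V l λ () }

  -- Two-armed countermodels and the cones above their arms.

  -- The Boolean `c` is the value of y at the root, the only place where the two models for given i,
  -- j differ.
  twoArm : ℕ → ℕ → Bool → Valuation F
  twoArm i j c = record { val = v ; mono = m }
    where
    v : ℕ → W → Bool
    v zero    r        = c
    v zero    _        = true
    v (suc x) r        = false
    v (suc x) a        = x ≡ᵇ i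
    v (suc x) b        = x ≡ᵇ j
    v (suc x) (inj₂ _) = true

    m : ∀ p {x y} → x ⊑ y → v p x ≡ true → v p y ≡ true
    m zero {r} {r} _ h = h
    m zero {inj₁ (suc _)} {r} (inl≤ ())
    m zero {_} {a} _ h = refl
    m zero {_} {b} _ h = refl
    m zero {_} {inj₂ _} _ h = refl
    m (suc p) {r} _ ()
    m (suc p) {a} (inl≤ ≤-same) h = h
    m (suc p) {b} (inl≤ ≤-same) h = h
    m (suc p) {inj₂ _} (inr≤ _) h = refl
    m (suc p) {a} cross h = refl
    m (suc p) {b} cross h = refl

  ≡ᵇ-refl : ∀ m → (m ≡ᵇ m) ≡ true
  ≡ᵇ-refl m = Equivalence.to T-≡ (≡⇒≡ᵇ m m refl)

  ≡ᵇ-true⇒≡ : ∀ m n → (m ≡ᵇ n) ≡ true → m ≡ n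
  ≡ᵇ-true⇒≡ m n h = ≡ᵇ⇒≡ m n (Equivalence.from T-≡ h)

  module _ {i j : ℕ} (i≢j : i ≢ j) (c : Bool) where

    ¬¬x-everywhere : ∀ x w → twoArm i j c ∣ w ⊩ ¬̇ ¬̇ var (suc x)
    ¬¬x-everywhere x = ¬¬-from-max (twoArm i j c) (var (suc x)) λ { max → refl }

    -- Every `x̂` has its premise forced everywhere, so on an arm `x̂ i` amounts to its variable,
    -- and each arm refutes one of the two implications.
    twoArm-⊮linear : ¬ (twoArm i j c ∣ r ⊩ linear (x̂ i) (x̂ j))
    twoArm-⊮linear (inj₁ h) = i≢j (sym (≡ᵇ-true⇒≡ j i
      (h a (inl≤ ≤-root) (λ { _ (inl≤ ≤-same) _ → ≡ᵇ-refl i ; _ cross _ → refl }) a (⊑-refl a) (¬¬x-everywhere j a))))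
    twoArm-⊮linear (inj₂ h) = i≢j (≡ᵇ-true⇒≡ i j
      (h b (inl≤ ≤-root) (λ { _ (inl≤ ≤-same) _ → ≡ᵇ-refl j ; _ cross _ → refl }) b (⊑-refl b) (¬¬x-everywhere i b)))

    twoArm-⊮Δ : ∀ {l} → i < l → j < l → ¬ (twoArm i j c ∣ r ⊩ Δ l)
    twoArm-⊮Δ {l} i<l j<l h = twoArm-⊮linear (⊩⋀<⁻ _ _ l _ (⊩⋀<⁻ _ _ l _ h i<l) j<l)

  module _ {i j l : ℕ} (i≢j : i ≢ j) (i<l : i < l) (j<l : j < l) where

    twoArm-⊮separating₀ : ¬ (twoArm i j true ∣ r ⊩ separating l 0)
    twoArm-⊮separating₀ h = twoArm-⊮Δ i≢j true i<l j<l (h r (⊑-refl r) refl)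

    twoArm-⊮separating₁ : ¬ (twoArm i j false ∣ r ⊩ separating l 1)
    twoArm-⊮separating₁ (inj₂ h) = twoArm-⊮Δ i≢j false i<l j<l h

  -- From an arm neither the root value `c` nor the other arm is visible, so the cone depends only
  -- on the arm's label k; `twoArm k k true` is its representative. All top worlds are identified
  -- because every variable is true there.
  data SameCone (i j k : ℕ) : W → W → Set where
    a~a     : i ≡ k → SameCone i j k a a
    b~a     : j ≡ k → SameCone i j k b a
    top~top : ∀ {x y} → SameCone i j k (inj₂ x) (inj₂ y)

  module _ {i j k : ℕ} {c : Bool} where

    sameCone-forces : ∀ A {w w′} → SameCone i j k w w′ →
                      (twoArm i j c ∣ w ⊩ A → twoArm k k true ∣ w′ ⊩ A) × (twoArm k k true ∣ w′ ⊩ A → twoArm i j c ∣ w ⊩ A)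
    sameCone-forces A z = bisimilar⁺ {P = λ _ → ⊤} (λ {x} _ → atom x) forth back A (AllVars-universal _ A) z
                        , bisimilar⁻ {P = λ _ → ⊤} (λ {x} _ → atom x) forth back A (AllVars-universal _ A) z
      where
      atom : ∀ x {w w′} → SameCone i j k w w′ → val (twoArm i j c) x w ≡ val (twoArm k k true) x w′
      atom zero    (a~a refl) = refl
      atom zero    (b~a refl) = refl
      atom zero    top~top    = refl
      atom (suc x) (a~a refl) = refl
      atom (suc x) (b~a refl) = refl
      atom (suc x) top~top    = refl

      forth : ∀ {w w′ v} → SameCone i j k w w′ → w ⊑ v → ∃ λ v′ → w′ ⊑ v′ × SameCone i j k v v′
      forth (a~a e) (inl≤ ≤-same) = a , ⊑-refl a , a~a e
      forth (a~a e) cross         = u , cross , top~top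
      forth (b~a e) (inl≤ ≤-same) = a , ⊑-refl a , b~a e
      forth (b~a e) cross         = u , cross , top~top
      forth top~top (inr≤ _)      = _ , ⊑-refl _ , top~top

      back : ∀ {w w′ v′} → SameCone i j k w w′ → w′ ⊑ v′ → ∃ λ v → w ⊑ v × SameCone i j k v v′
      back (a~a e) (inl≤ ≤-same) = a , ⊑-refl a , a~a e
      back (a~a e) cross         = u , cross , top~top
      back (b~a e) (inl≤ ≤-same) = b , ⊑-refl b , b~a e
      back (b~a e) cross         = u , cross , top~top
      back top~top (inr≤ _)      = _ , ⊑-refl _ , top~top

  -- Images under a substitution and their gluing.

  module _ (α : Subst) where

    image : ℕ → ℕ → Bool → Valuation F
    image i j c = pullback α (twoArm i j c)

    image-sameCone : ∀ {i j k c w w′} x → SameCone i j k w w′ → val (image i j c) x w ≡ val (image k k true) x w′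
    image-sameCone {i} {j} {k} {c} x z =
      does-⇔ (mk⇔ (proj₁ (sameCone-forces {c = c} (α x) z)) (proj₂ (sameCone-forces {c = c} (α x) z)))
             (forces? (twoArm i j c) _ (α x)) (forces? (twoArm k k true) _ (α x))

    arm : ℕ → ℕ → Bool
    arm i x = val (image i i true) x a

    image-top : ∀ {i j c} x {y z} → val (image i j c) x (inj₂ y) ≡ val (image 0 0 true) x (inj₂ z)
    image-top x = image-sameCone {k = 0} x top~top

    -- The arms a, b carry the roots of the images for the two values of var 0; u carries their common arm i.
    glued : ℕ → ℕ → Valuation F
    glued i j = record { val = v ; mono = m }
      where
      v : ℕ → W → Bool
      v x r        = false
      v x a        = val (image i j true) x r
      v x b        = val (image i j false) x r
      v x u        = arm i x
      v x (leaf _) = val (image 0 0 true) x u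

      m : ∀ p {x y} → x ⊑ y → v p x ≡ true → v p y ≡ true
      m p {r} _ ()
      m p {a} (inl≤ ≤-same) h = h
      m p {b} (inl≤ ≤-same) h = h
      m p {a} {u} cross h = trans (sym (image-sameCone {j = j} {c = true} p (a~a refl))) (mono (image i j true) p (inl≤ ≤-root) h)
      m p {b} {u} cross h = trans (sym (image-sameCone {j = j} {c = false} p (a~a refl))) (mono (image i j false) p (inl≤ ≤-root) h)
      m p {a} {leaf _} cross h = trans (sym (image-top p)) (mono (image i j true) p (cross {b = zero}) h)
      m p {b} {leaf _} cross h = trans (sym (image-top p)) (mono (image i j false) p (cross {b = zero}) h)
      m p {u} {u} _ h = h
      m p {u} {leaf _} _ h = trans (sym (image-top {i} {i} {true} p)) (mono (image i i true) p (cross {b = zero}) h)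
      m p {leaf _} {leaf _} _ h = h
      m p {leaf _} {u} (inr≤ ())

    module _ {i j k : ℕ} (arms≡ : ∀ {x} → x < k → arm i x ≡ arm j x) where

      -- Here `w₀` is an arm of the glued model and plays the root of an image. The single world `u`
      -- stands for both arms of that image, and each leaf for its whole top.
      data Glue (w₀ : W) : W → W → Set where
        root : Glue w₀ w₀ r
        arm₁ : Glue w₀ u a
        arm₂ : Glue w₀ u b
        top  : ∀ {x y} → Glue w₀ (leaf x) (inj₂ y)

      module _ (w₀ : W) (c : Bool) (w₀⊑u : w₀ ⊑ u) (only : ∀ {v} → w₀ ⊑ v → v ≡ w₀ ⊎ u ⊑ v)
               (at : ∀ x → val (glued i j) x w₀ ≡ val (image i j c) x r) where

        glued-⊩ : ∀ A → AllVars (_< k) A → glued i j ∣ w₀ ⊩ A → image i j c ∣ r ⊩ A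
        glued-⊩ A A<k = bisimilar⁺ atom forth back A A<k root
          where
          atom : ∀ {x w w′} → x < k → Glue w₀ w w′ → val (glued i j) x w ≡ val (image i j c) x w′
          atom {x} x<k root = at x
          atom {x} x<k arm₁ = sym (image-sameCone {j = j} {c = c} x (a~a refl))
          -- Only here does the collision of the arms enter: `u` carries arm i, whereas `b` in the
          -- image carries arm j.
          atom {x} x<k arm₂ = trans (arms≡ x<k) (sym (image-sameCone {i} {c = c} x (b~a refl)))
          atom {x} x<k top  = sym (image-top x)

          forth : ∀ {w w′ v} → Glue w₀ w w′ → w ⊑ v → ∃ λ v′ → w′ ⊑ v′ × Glue w₀ v v′
          forth root w₀⊑v with only w₀⊑v
          ... | inj₁ refl          = r , ⊑-refl r , root
          ... | inj₂ (inr≤ ≤-same) = a , inl≤ ≤-root , arm₁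
          ... | inj₂ (inr≤ {b = zero}  ≤-root) = a , inl≤ ≤-root , arm₁
          ... | inj₂ (inr≤ {b = suc _} ≤-root) = u , cross , top
          forth {v = u}      arm₁ _ = a , ⊑-refl a , arm₁
          forth {v = leaf _} arm₁ _ = u , cross , top
          forth {v = u}      arm₂ _ = b , ⊑-refl b , arm₂
          forth {v = leaf _} arm₂ _ = u , cross , top
          forth top (inr≤ ≤-same)   = _ , ⊑-refl _ , top

          back : ∀ {w w′ v′} → Glue w₀ w w′ → w′ ⊑ v′ → ∃ λ v → w ⊑ v × Glue w₀ v v′
          back {v′ = r}      root _ = w₀ , ⊑-refl w₀ , root
          back {v′ = a}      root _ = u , w₀⊑u , arm₁
          back {v′ = b}      root _ = u , w₀⊑u , arm₂
          back {v′ = inj₂ _} root _ = leaf zero , ⊑-trans w₀⊑u (inr≤ ≤-root) , top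
          back arm₁ (inl≤ ≤-same)   = u , ⊑-refl u , arm₁
          back arm₁ cross           = leaf zero , inr≤ ≤-root , top
          back arm₂ (inl≤ ≤-same)   = u , ⊑-refl u , arm₂
          back arm₂ cross           = leaf zero , inr≤ ≤-root , top
          back top (inr≤ _)         = _ , ⊑-refl _ , top

      glued-⊩ᵃ : ∀ A → AllVars (_< k) A → glued i j ∣ a ⊩ A → image i j true ∣ r ⊩ A
      glued-⊩ᵃ = glued-⊩ a true cross (λ { (inl≤ ≤-same) → inj₁ refl ; cross → inj₂ (inr≤ ≤-root) }) λ _ → refl

      glued-⊩ᵇ : ∀ A → AllVars (_< k) A → glued i j ∣ b ⊩ A → image i j false ∣ r ⊩ A
      glued-⊩ᵇ = glued-⊩ b false cross (λ { (inl≤ ≤-same) → inj₁ refl ; cross → inj₂ (inr≤ ≤-root) }) λ _ → refl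

      no-disjunction : ∀ B C → AllVars (_< k) B → AllVars (_< k) C → Valid F (B ∨ C) →
                       image i j true ∣ r ⊩ B ⊎ image i j false ∣ r ⊩ C
      no-disjunction B C B<k C<k valid with valid (glued i j) r
      ... | inj₁ h = inj₁ (glued-⊩ᵃ B B<k (persistent (glued i j) B (inl≤ ≤-root) h))
      ... | inj₂ h = inj₂ (glued-⊩ᵇ C C<k (persistent (glued i j) C (inl≤ ≤-root) h))

    -- An arm restricted to k variables is one of 2^k Boolean patterns, coded as an element of
    -- `Fin (2 ^ k)`; one label more forces a repetition.
    arms-collide : ∀ k → ∃ λ i → ∃ λ j → i < suc (2 ^ k) × j < suc (2 ^ k) × i ≢ j × (∀ {x} → x < k → arm i x ≡ arm j x)
    arms-collide k with pigeonhole (n<1+n (2 ^ k)) code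
      where
      open Inverse 2↔Bool using (from)
      code : Fin (suc (2 ^ k)) → Fin (2 ^ k)
      code i = funToFin {k} λ x → from (arm (toℕ i) (toℕ x))
    ... | i , j , i<j , eq = toℕ i , toℕ j , toℕ<n i , toℕ<n j , <⇒≢ i<j , agree
      where
      open Inverse 2↔Bool using (to; from; strictlyInverseˡ)
      agreeF : ∀ x → from (arm (toℕ i) (toℕ x)) ≡ from (arm (toℕ j) (toℕ x))
      agreeF x = trans (sym (finToFun-funToFin {k} (λ x → from (arm (toℕ i) (toℕ x))) x))
                       (trans (cong (λ z → finToFun z x) eq) (finToFun-funToFin {k} (λ x → from (arm (toℕ j) (toℕ x))) x))
      agree : ∀ {x} → x < k → arm (toℕ i) x ≡ arm (toℕ j) x
      agree x<k = subst (λ x → arm (toℕ i) x ≡ arm (toℕ j) x) (toℕ-fromℕ< x<k)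
        (trans (sym (strictlyInverseˡ _)) (trans (cong to (agreeF (fromℕ< x<k))) (strictlyInverseˡ _)))

  -- Absence of a most general unifier, and nullarity.

  no-most-general : ∀ ε → Unifier goal ε → ∃ λ μ → Unifier goal μ × ¬ (μ ≼ ε)
  no-most-general ε uε with ∃-bound₂ (ε 0) (ε 1)
  ... | k , ε₀<k , ε₁<k = separating l , separating-unifier l , ⋠
    where
    l : ℕ
    l = suc (2 ^ k)

    ⋠ : ¬ (separating l ≼ ε)
    ⋠ (via α αε=μ) with arms-collide α k
    ... | i , j , i<l , j<l , i≢j , arms≡
      -- The third conjunct of `goal` makes `ε 0 ∨ ε 1` valid. Either outcome, carried back through
      -- `α`, forces a component of `separating l` at a root that refutes it.
      with no-disjunction α arms≡ (ε 0) (ε 1) ε₀<k ε₁<k (λ V w → proj₂ (proj₂ (uε V w)))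
    ...   | inj₁ h = twoArm-⊮separating₀ i≢j i<l j<l
                       (proj₁ (αε=μ 0 (twoArm i j true) r) r (⊑-refl r) (⊩-[]⁺ α _ (ε 0) h))
    ...   | inj₂ h = twoArm-⊮separating₁ i≢j i<l j<l
                       (proj₁ (αε=μ 1 (twoArm i j false) r) r (⊑-refl r) (⊩-[]⁺ α _ (ε 1) h))

  nullary : NullaryUnification
  nullary = goal , unifiable , directed⇒¬minimal goal unifiable
    (λ σ τ uσ uτ → join σ τ , join-unifier σ τ uσ uτ , ≼-joinˡ σ τ , ≼-joinʳ σ τ)
    no-most-general
    where
    unifiable : Unifiable goal
    unifiable = separating 0 , separating-unifier 0

theorem5p7 : ∀ (s : ℕ) → s ≥ 1 → Unification.NullaryUnification (Fork 2 +ᶠ Fork s)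
theorem5p7 (suc n) _ = ForkOverFork.nullary n
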